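{- Let $\Gamma$ be a finite simple graph on $v$ vertices and let $s$ be a positive integer. Let $\mathcal{F}_s(\Gamma)$ be a set of pairs $(k,\lambda)$ of real numbers which contains every pair $(\langle k\rangle_S,\langle\lambda\rangle_S)$ arising from an $s$-clique $S$ of $\Gamma$. Let $$\mathrm{CA}_\Gamma(x,s,k,\lambda):=x(x+1)(v-s)-2xs(k-s+1)+s(s-1)(\lambda-s+2).$$ If, for every $(k,\lambda)\in\mathcal{F}_s(\Gamma)$, there exists an integer $x$ such that $\mathrm{CA}_\Gamma(x,s,k,\lambda)<0$, then $\Gamma$ contains no clique of size $s$.
   Context: For a graph $\Gamma$ and a vertex $u$, $\Gamma(u)$ denotes the set of neighbours of $u$. An $s$-clique is a set $S$ of $s$ pairwise adjacent vertices. For a clique $S$, $$\langle k\rangle_S:=\frac{1}{|S|}\sum_{u\in S}\deg_\Gamma(u),\qquad \langle\lambda\rangle_S:=\binom{|S|}{2}^{ -1}\sum_{\{u,w\}\in\binom{S}{2}}|\Gamma(u)\cap\Gamma(w)|.$$ For $|S|=1$ the second average is empty and is taken to be $0$. -}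

module Defs where

open import Data.Fin as Fin using (Fin)
open import Data.Fin.Subset using (Subset; _∈_; _∩_; ∣_∣)
open import Data.Fin.Subset.Properties using (_∈?_)
open import Data.Integer as ℤ using (ℤ; +_)
open import Data.List.Base using (List; map; filter; allFin; cartesianProduct)
open import Data.Nat as ℕ using (ℕ; zero; suc)
open import Data.Nat.Combinatorics using (_C_)
open import Data.Nat.ListAction using (sum)
import Data.Nat.Properties as ℕ
open import Data.Product using (_×_; _,_; ∃-syntax)
open import Data.Rational as ℚ using (ℚ; 0ℚ; 1ℚ; ½; Positive)
import Data.Rational.Properties as ℚ
open import Data.Rational.Solver using (module +-*-Solver)
open import Data.Vec.Base using (tabulate)
open import Level using (0ℓ)
open import Relation.Binary.Core using (Rel)
open import Relation.Binary.Definitions using (Decidable; Symmetric; Irreflexive)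
open import Relation.Binary.PropositionalEquality
  using (_≡_; _≢_; refl; sym; trans; cong; cong₂; subst; module ≡-Reasoning)
open import Relation.Nullary using (does)

------------------------------------------------------------------------
-- Real numbers, as Cauchy sequences of rationals

IsCauchy : (ℕ → ℚ) → Set
IsCauchy x = ∀ ε → 0ℚ ℚ.< ε →
  ∃[ N ] (∀ m n → N ℕ.≤ m → N ℕ.≤ n → ℚ.∣ x m ℚ.- x n ∣ ℚ.< ε)

private
  open +-*-Solver using (solve; _:+_; _:-_; :-_; _:=_)

  const-cauchy : ∀ q → IsCauchy (λ _ → q)
  const-cauchy q ε 0<ε = 0 , λ _ _ _ _ →
    subst (ℚ._< ε) (sym (cong ℚ.∣_∣ (ℚ.+-inverseʳ q))) 0<ε

  ½*-pos : ∀ {ε} → 0ℚ ℚ.< ε → 0ℚ ℚ.< ½ ℚ.* ε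
  ½*-pos {ε} 0<ε = subst (ℚ._< ½ ℚ.* ε) (ℚ.*-zeroʳ ½) (ℚ.*-monoʳ-<-pos ½ 0<ε)

  halves : ∀ ε → ½ ℚ.* ε ℚ.+ ½ ℚ.* ε ≡ ε
  halves ε = trans (sym (ℚ.*-distribʳ-+ ε ½ ½)) (ℚ.*-identityˡ ε)

  +-cauchy : ∀ x y → IsCauchy x → IsCauchy y → IsCauchy (λ n → x n ℚ.+ y n)
  +-cauchy x y cx cy ε 0<ε
    with M , hx ← cx (½ ℚ.* ε) (½*-pos 0<ε)
       | N , hy ← cy (½ ℚ.* ε) (½*-pos 0<ε)
    = M ℕ.⊔ N , λ m n M⊔N≤m M⊔N≤n → begin-strict
      ℚ.∣ (x m ℚ.+ y m) ℚ.- (x n ℚ.+ y n) ∣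
        ≡⟨ cong ℚ.∣_∣ (solve 4 (λ a b c d →
             (a :+ b) :- (c :+ d) := (a :- c) :+ (b :- d)) refl (x m) (y m) (x n) (y n)) ⟩
      ℚ.∣ (x m ℚ.- x n) ℚ.+ (y m ℚ.- y n) ∣
        ≤⟨ ℚ.∣p+q∣≤∣p∣+∣q∣ (x m ℚ.- x n) (y m ℚ.- y n) ⟩
      ℚ.∣ x m ℚ.- x n ∣ ℚ.+ ℚ.∣ y m ℚ.- y n ∣
        <⟨ ℚ.+-mono-<
             (hx m n (ℕ.m⊔n≤o⇒m≤o M N M⊔N≤m) (ℕ.m⊔n≤o⇒m≤o M N M⊔N≤n))
             (hy m n (ℕ.m⊔n≤o⇒n≤o M N M⊔N≤m) (ℕ.m⊔n≤o⇒n≤o M N M⊔N≤n)) ⟩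
      ½ ℚ.* ε ℚ.+ ½ ℚ.* ε
        ≡⟨ halves ε ⟩
      ε ∎
    where open ℚ.≤-Reasoning

  neg-cauchy : ∀ x → IsCauchy x → IsCauchy (λ n → ℚ.- x n)
  neg-cauchy x cx ε 0<ε with N , hx ← cx ε 0<ε
    = N , λ m n N≤m N≤n → subst (ℚ._< ε) (eq (x m) (x n)) (hx m n N≤m N≤n)
    where
    eq : ∀ a b → ℚ.∣ a ℚ.- b ∣ ≡ ℚ.∣ (ℚ.- a) ℚ.- (ℚ.- b) ∣
    eq a b = trans (sym (ℚ.∣-p∣≡∣p∣ (a ℚ.- b)))
      (cong ℚ.∣_∣ (solve 2 (λ a b → :- (a :- b) := (:- a) :- (:- b)) refl a b))

  eventually-bounded : ∀ x → IsCauchy x →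
    ∃[ B ] Positive B × ∃[ N ] (∀ n → N ℕ.≤ n → ℚ.∣ x n ∣ ℚ.≤ B)
  eventually-bounded x cx with N , hx ← cx 1ℚ (ℚ.positive⁻¹ 1ℚ)
    = 1ℚ ℚ.+ ℚ.∣ x N ∣
    , ℚ.pos+nonNeg⇒pos 1ℚ ℚ.∣ x N ∣ {{ℚ.∣-∣-nonNeg (x N)}}
    , N , λ n N≤n → begin
      ℚ.∣ x n ∣
        ≡⟨ cong ℚ.∣_∣ (solve 2 (λ a b → a := (a :- b) :+ b) refl (x n) (x N)) ⟩
      ℚ.∣ (x n ℚ.- x N) ℚ.+ x N ∣
        ≤⟨ ℚ.∣p+q∣≤∣p∣+∣q∣ (x n ℚ.- x N) (x N) ⟩
      ℚ.∣ x n ℚ.- x N ∣ ℚ.+ ℚ.∣ x N ∣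
        ≤⟨ ℚ.+-monoˡ-≤ ℚ.∣ x N ∣ (ℚ.<⇒≤ (hx n N N≤n ℕ.≤-refl)) ⟩
      1ℚ ℚ.+ ℚ.∣ x N ∣ ∎
    where open ℚ.≤-Reasoning

  *-distribˡ-- : ∀ a b c → a ℚ.* (b ℚ.- c) ≡ a ℚ.* b ℚ.- a ℚ.* c
  *-distribˡ-- a b c = trans (ℚ.*-distribˡ-+ a b (ℚ.- c))
    (cong (a ℚ.* b ℚ.+_) (sym (ℚ.neg-distribʳ-* a c)))

  split : ∀ a b c d → a ℚ.* b ℚ.- c ℚ.* d ≡ a ℚ.* (b ℚ.- d) ℚ.+ d ℚ.* (a ℚ.- c)
  split a b c d = begin
    a ℚ.* b ℚ.- c ℚ.* d
      ≡⟨ solve 3 (λ p q r → p :- r := (p :- q) :+ (q :- r)) refl (a ℚ.* b) (a ℚ.* d) (c ℚ.* d) ⟩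
    (a ℚ.* b ℚ.- a ℚ.* d) ℚ.+ (a ℚ.* d ℚ.- c ℚ.* d)
      ≡⟨ cong₂ (λ p q → (a ℚ.* b ℚ.- a ℚ.* d) ℚ.+ (p ℚ.- q)) (ℚ.*-comm a d) (ℚ.*-comm c d) ⟩
    (a ℚ.* b ℚ.- a ℚ.* d) ℚ.+ (d ℚ.* a ℚ.- d ℚ.* c)
      ≡⟨ cong₂ ℚ._+_ (*-distribˡ-- a b d) (*-distribˡ-- d a c) ⟨
    a ℚ.* (b ℚ.- d) ℚ.+ d ℚ.* (a ℚ.- c) ∎
    where open ≡-Reasoning

  ∣pq∣<Dδ : ∀ D .{{_ : Positive D}} δ p q → ℚ.∣ p ∣ ℚ.≤ D → ℚ.∣ q ∣ ℚ.< δ →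
            ℚ.∣ p ℚ.* q ∣ ℚ.< D ℚ.* δ
  ∣pq∣<Dδ D δ p q p≤D q<δ = begin-strict
    ℚ.∣ p ℚ.* q ∣       ≡⟨ ℚ.∣p*q∣≡∣p∣*∣q∣ p q ⟩
    ℚ.∣ p ∣ ℚ.* ℚ.∣ q ∣ ≤⟨ ℚ.*-monoʳ-≤-nonNeg ℚ.∣ q ∣ {{ℚ.∣-∣-nonNeg q}} p≤D ⟩
    D ℚ.* ℚ.∣ q ∣       <⟨ ℚ.*-monoʳ-<-pos D q<δ ⟩
    D ℚ.* δ             ∎
    where open ℚ.≤-Reasoning

  scale : ∀ D .{{_ : Positive D}} ε → 0ℚ ℚ.< ε → ∃[ δ ] 0ℚ ℚ.< δ × D ℚ.* δ ≡ ε
  scale D ε 0<ε = 1/D ℚ.* ε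
    , subst (ℚ._< 1/D ℚ.* ε) (ℚ.*-zeroʳ 1/D)
        (ℚ.*-monoʳ-<-pos 1/D {{ℚ.1/pos⇒pos D}} 0<ε)
    , trans (sym (ℚ.*-assoc D 1/D ε))
        (trans (cong (ℚ._* ε) (ℚ.*-inverseʳ D {{ℚ.pos⇒nonZero D}})) (ℚ.*-identityˡ ε))
    where 1/D = (ℚ.1/ D) {{ℚ.pos⇒nonZero D}}

  product-close : ∀ A B .{{_ : Positive A}} .{{_ : Positive B}} δ a b c d →
    ℚ.∣ a ∣ ℚ.≤ A → ℚ.∣ d ∣ ℚ.≤ B → ℚ.∣ b ℚ.- d ∣ ℚ.< δ → ℚ.∣ a ℚ.- c ∣ ℚ.< δ →
    ℚ.∣ a ℚ.* b ℚ.- c ℚ.* d ∣ ℚ.< (A ℚ.+ B) ℚ.* δ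
  product-close A B δ a b c d a≤A d≤B b-d<δ a-c<δ = begin-strict
    ℚ.∣ a ℚ.* b ℚ.- c ℚ.* d ∣
      ≡⟨ cong ℚ.∣_∣ (split a b c d) ⟩
    ℚ.∣ a ℚ.* (b ℚ.- d) ℚ.+ d ℚ.* (a ℚ.- c) ∣
      ≤⟨ ℚ.∣p+q∣≤∣p∣+∣q∣ (a ℚ.* (b ℚ.- d)) (d ℚ.* (a ℚ.- c)) ⟩
    ℚ.∣ a ℚ.* (b ℚ.- d) ∣ ℚ.+ ℚ.∣ d ℚ.* (a ℚ.- c) ∣
      <⟨ ℚ.+-mono-< (∣pq∣<Dδ A δ a (b ℚ.- d) a≤A b-d<δ) (∣pq∣<Dδ B δ d (a ℚ.- c) d≤B a-c<δ) ⟩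
    A ℚ.* δ ℚ.+ B ℚ.* δ
      ≡⟨ ℚ.*-distribʳ-+ δ A B ⟨
    (A ℚ.+ B) ℚ.* δ ∎
    where open ℚ.≤-Reasoning

  *-cauchy : ∀ x y → IsCauchy x → IsCauchy y → IsCauchy (λ n → x n ℚ.* y n)
  *-cauchy x y cx cy ε 0<ε =
    let A , A>0 , K , bx = eventually-bounded x cx
        B , B>0 , L , by = eventually-bounded y cy
        δ , 0<δ , eq = scale (A ℚ.+ B) {{ℚ.pos+pos⇒pos A {{A>0}} B {{B>0}}}} ε 0<ε
        M , hx = cx δ 0<δ
        N , hy = cy δ 0<δ
    in (K ℕ.⊔ L) ℕ.⊔ (M ℕ.⊔ N) , λ m n ≤m ≤n →
      let KL≤m = ℕ.m⊔n≤o⇒m≤o (K ℕ.⊔ L) (M ℕ.⊔ N) ≤m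
          KL≤n = ℕ.m⊔n≤o⇒m≤o (K ℕ.⊔ L) (M ℕ.⊔ N) ≤n
          MN≤m = ℕ.m⊔n≤o⇒n≤o (K ℕ.⊔ L) (M ℕ.⊔ N) ≤m
          MN≤n = ℕ.m⊔n≤o⇒n≤o (K ℕ.⊔ L) (M ℕ.⊔ N) ≤n
      in subst (ℚ.∣ x m ℚ.* y m ℚ.- x n ℚ.* y n ∣ ℚ.<_) eq
           (product-close A B {{A>0}} {{B>0}} δ (x m) (y m) (x n) (y n)
             (bx m (ℕ.m⊔n≤o⇒m≤o K L KL≤m))
             (by n (ℕ.m⊔n≤o⇒n≤o K L KL≤n))
             (hy m n (ℕ.m⊔n≤o⇒n≤o M N MN≤m) (ℕ.m⊔n≤o⇒n≤o M N MN≤n))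
             (hx m n (ℕ.m⊔n≤o⇒m≤o M N MN≤m) (ℕ.m⊔n≤o⇒m≤o M N MN≤n)))

record ℝ : Set where
  constructor mkℝ
  field
    seq    : ℕ → ℚ
    cauchy : IsCauchy seq

open ℝ public

infix  4 _≃_ _<_
infixl 6 _+_ _-_
infixl 7 _*_
infix  8 -_

-- Equality of reals: the difference of the two sequences tends to 0.
_≃_ : Rel ℝ 0ℓ
x ≃ y = ∀ ε → 0ℚ ℚ.< ε →
  ∃[ N ] (∀ n → N ℕ.≤ n → ℚ.∣ seq x n ℚ.- seq y n ∣ ℚ.< ε)

-- The gap ε is needed: termwise < in the tail would not respect _≃_.
_<_ : Rel ℝ 0ℓ
x < y = ∃[ ε ] 0ℚ ℚ.< ε ×
  ∃[ N ] (∀ n → N ℕ.≤ n → seq x n ℚ.+ ε ℚ.≤ seq y n)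

fromℚ : ℚ → ℝ
fromℚ q = mkℝ (λ _ → q) (const-cauchy q)

fromℤ : ℤ → ℝ
fromℤ i = fromℚ (i ℚ./ 1)

fromℕ : ℕ → ℝ
fromℕ n = fromℤ (+ n)

_+_ : ℝ → ℝ → ℝ
x + y = mkℝ (λ n → seq x n ℚ.+ seq y n) (+-cauchy (seq x) (seq y) (cauchy x) (cauchy y))

_*_ : ℝ → ℝ → ℝ
x * y = mkℝ (λ n → seq x n ℚ.* seq y n) (*-cauchy (seq x) (seq y) (cauchy x) (cauchy y))

-_ : ℝ → ℝ
- x = mkℝ (λ n → ℚ.- seq x n) (neg-cauchy (seq x) (cauchy x))

_-_ : ℝ → ℝ → ℝ
x - y = x + (- y)

_≃₂_ : Rel (ℝ × ℝ) 0ℓ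
(a , b) ≃₂ (c , d) = a ≃ c × b ≃ d

------------------------------------------------------------------------
-- Finite simple graphs

record Graph (v : ℕ) : Set₁ where
  field
    Adj    : Rel (Fin v) 0ℓ
    adj?   : Decidable Adj
    symm   : Symmetric Adj
    irrefl : Irreflexive _≡_ Adj

elements : ∀ {v} → Subset v → List (Fin v)
elements S = filter (_∈? S) (allFin _)

-- Each 2-element subset {u,w} of S is listed once, as (u , w) with u < w.
pairs : ∀ {v} → Subset v → List (Fin v × Fin v)
pairs S = filter (λ (u , w) → u Fin.<? w) (cartesianProduct (elements S) (elements S))

-- The average of n numbers with sum t; the empty average is 0.
average : (t n : ℕ) → ℚ
average t zero      = 0ℚ
average t n@(suc _) = + t ℚ./ n

module _ {v} (Γ : Graph v) where
  open Graph Γ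

  neighbours : Fin v → Subset v
  neighbours u = tabulate (λ w → does (adj? u w))

  degree : Fin v → ℕ
  degree u = ∣ neighbours u ∣

  commonNeighbours : Fin v → Fin v → ℕ
  commonNeighbours u w = ∣ neighbours u ∩ neighbours w ∣

  IsClique : ℕ → Subset v → Set
  IsClique s S = ∣ S ∣ ≡ s × (∀ {u w} → u ∈ S → w ∈ S → u ≢ w → Adj u w)

  ⟨k⟩ : Subset v → ℚ
  ⟨k⟩ S = average (sum (map degree (elements S))) ∣ S ∣

  ⟨λ⟩ : Subset v → ℚ
  ⟨λ⟩ S = average (sum (map (λ (u , w) → commonNeighbours u w) (pairs S))) (∣ S ∣ C 2)

  CA : (x : ℤ) (s : ℕ) (k l : ℝ) → ℝ
  CA x s k l =
      X * (X + 1#) * (fromℕ v - S)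
    - 2# * X * S * (k - S + 1#)
    + S * (S - 1#) * (l - S + 2#)
    where
    X  = fromℤ x
    S  = fromℕ s
    1# = fromℕ 1
    2# = fromℕ 2

-- For a clique S of size s let m z be the number of neighbours of z in S. The integer
-- (m z - x)(m z - x - 1) is never negative, and equals (s-1-x)(s-2-x) for z in S. By double
-- counting, its sum over the vertices z outside S is CA(x,s,⟨k⟩,⟨λ⟩), so CA ≥ 0 for every integer x.

module Submission where

open import Defs
open import Data.Integer using (ℤ)
open import Data.Nat using (ℕ; NonZero)
open import Data.Product using (_×_; _,_; ∃-syntax)
open import Data.Fin.Subset using (Subset)
open import Relation.Binary.Definitions using (_Respects_)
open import Relation.Nullary using (¬_)
open import Relation.Unary using (Pred; _∈_)

open import Data.Bool.Base using (Bool; true; false; _∧_)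
open import Data.Fin as Fin using (Fin; zero; suc; punchIn)
open import Data.Fin.Properties using (punchInᵢ≢i)
open import Data.Fin.Subset as Subset using (_∩_; ∣_∣; inside; outside)
open import Data.Fin.Subset.Properties using (_∈?_)
open import Data.Integer as ℤ using (+_; -[1+_]; +≤+)
import Data.Integer.Properties as ℤ
import Data.Integer.Tactic.RingSolver as ℤ-Ring
open import Data.List.Base as List using (List; []; _∷_; _++_; filter; map; length; allFin; cartesianProduct)
import Data.List.Properties as List
open import Data.Nat as ℕ using (zero; suc; z≤n)
open import Data.Nat.Combinatorics using (_C_; nC1≡n; nCk+nC[k+1]≡[n+1]C[k+1])
open import Data.Nat.ListAction using (sum)
open import Data.Nat.ListAction.Properties using (sum-++)
import Data.Nat.Properties as ℕ
import Data.Nat.Tactic.RingSolver as ℕ-Ring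
open import Data.Rational as ℚ using (ℚ; 0ℚ)
import Data.Rational.Properties as ℚ
open import Data.Rational.Solver using (module +-*-Solver)
open import Data.Rational.Unnormalised as ℚᵘ using (mkℚᵘ; *≡*)
import Data.Rational.Unnormalised.Properties as ℚᵘ
open import Data.Product using (proj₁; proj₂)
open import Data.Vec.Base as Vec using (_∷_; lookup)
import Data.Vec.Properties as Vec
open import Function.Base using (_∘_)
open import Relation.Binary.PropositionalEquality
open import Relation.Nullary using (Dec; yes; no; does)
open import Relation.Nullary.Decidable using (dec-true; dec-false)

open import Algebra.Properties.Semiring.Sum ℕ.+-*-semiring
  using (*-distribˡ-sum; ∑-distrib-+; sum-cong-≗; sum-replicate-zero; sum-remove)
  renaming (sum to ∑)

-- Indicators and finite sums of natural numbers.

𝟙 : Bool → ℕ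
𝟙 true  = 1
𝟙 false = 0

𝟙-idem : ∀ b → 𝟙 b ℕ.* 𝟙 b ≡ 𝟙 b
𝟙-idem true  = refl
𝟙-idem false = refl

𝟙-∧ : ∀ a b → 𝟙 (a ∧ b) ≡ 𝟙 a ℕ.* 𝟙 b
𝟙-∧ true  b = sym (ℕ.*-identityˡ (𝟙 b))
𝟙-∧ false b = refl

module _ {A : Set} where

  sum-filter : ∀ {p} {P : Pred A p} (P? : ∀ x → Dec (P x)) (f : A → ℕ) xs →
    sum (map f (filter P? xs)) ≡ sum (map (λ x → 𝟙 (does (P? x)) ℕ.* f x) xs)
  sum-filter P? f [] = refl
  sum-filter P? f (x ∷ xs) with does (P? x)
  ... | true  = cong₂ ℕ._+_ (sym (ℕ.*-identityˡ (f x))) (sum-filter P? f xs)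
  ... | false = sum-filter P? f xs

  sum-cartesianProduct : ∀ {B : Set} (f : A × B → ℕ) xs ys →
    sum (map f (cartesianProduct xs ys)) ≡ sum (map (λ x → sum (map (λ y → f (x , y)) ys)) xs)
  sum-cartesianProduct f []       ys = refl
  sum-cartesianProduct f (x ∷ xs) ys = begin
    sum (map f (map (x ,_) ys ++ cartesianProduct xs ys))
      ≡⟨ cong sum (List.map-++ f (map (x ,_) ys) _) ⟩
    sum (map f (map (x ,_) ys) ++ map f (cartesianProduct xs ys))
      ≡⟨ sum-++ (map f (map (x ,_) ys)) _ ⟩
    sum (map f (map (x ,_) ys)) ℕ.+ sum (map f (cartesianProduct xs ys))
      ≡⟨ cong₂ ℕ._+_ (cong sum (sym (List.map-∘ ys))) (sum-cartesianProduct f xs ys) ⟩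
    sum (map (λ y → f (x , y)) ys) ℕ.+ sum (map (λ x → sum (map (λ y → f (x , y)) ys)) xs) ∎
    where open ≡-Reasoning

  sum-∑-comm : ∀ {n} (f : A → Fin n → ℕ) xs →
    sum (map (λ x → ∑ (f x)) xs) ≡ ∑ (λ i → sum (map (λ x → f x i) xs))
  sum-∑-comm {n} f []       = sym (sum-replicate-zero n)
  sum-∑-comm     f (x ∷ xs) = trans (cong (∑ (f x) ℕ.+_) (sum-∑-comm f xs))
    (sym (∑-distrib-+ (f x) (λ i → sum (map (λ x → f x i) xs))))

  sum-map-1 : (xs : List A) → sum (map (λ _ → 1) xs) ≡ length xs
  sum-map-1 []       = refl
  sum-map-1 (x ∷ xs) = cong suc (sum-map-1 xs)

sum-allFin : ∀ {n} (f : Fin n → ℕ) → sum (map f (allFin n)) ≡ ∑ f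
sum-allFin f = trans (cong sum (List.map-tabulate (λ i → i) f)) (sum-tabulate f)
  where
  sum-tabulate : ∀ {n} (f : Fin n → ℕ) → sum (List.tabulate f) ≡ ∑ f
  sum-tabulate {zero}  f = refl
  sum-tabulate {suc n} f = cong (f zero ℕ.+_) (sum-tabulate (f ∘ suc))

-- Expanding the square of `∑ c` gives each diagonal term once and each product with `u < w` twice.
-- The diagonal is added on the left rather than subtracted on the right, which keeps the identity
-- in ℕ.
∑<-square : ∀ {n} (c : Fin n → ℕ) →
  2 ℕ.* ∑ (λ u → ∑ (λ w → 𝟙 (does (u Fin.<? w)) ℕ.* (c u ℕ.* c w))) ℕ.+ ∑ (λ u → c u ℕ.* c u)
    ≡ ∑ c ℕ.* ∑ c
∑<-square {zero}  c = refl
∑<-square {suc n} c = begin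
  -- The comparisons with `zero` compute: row `zero` keeps every later index, column `zero`
  -- vanishes, and the rest is the sum `T` for `c′`.
  2 ℕ.* (∑ (λ w → 1 ℕ.* (c₀ ℕ.* c′ w)) ℕ.+ T) ℕ.+ (c₀ ℕ.* c₀ ℕ.+ Q)
    ≡⟨ cong (λ t → 2 ℕ.* (t ℕ.+ T) ℕ.+ (c₀ ℕ.* c₀ ℕ.+ Q)) row ⟩
  2 ℕ.* (c₀ ℕ.* ∑ c′ ℕ.+ T) ℕ.+ (c₀ ℕ.* c₀ ℕ.+ Q)
    ≡⟨ regroup c₀ (∑ c′) T Q ⟩
  (c₀ ℕ.* c₀ ℕ.+ 2 ℕ.* (c₀ ℕ.* ∑ c′)) ℕ.+ (2 ℕ.* T ℕ.+ Q)
    ≡⟨ cong (c₀ ℕ.* c₀ ℕ.+ 2 ℕ.* (c₀ ℕ.* ∑ c′) ℕ.+_) (∑<-square c′) ⟩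
  (c₀ ℕ.* c₀ ℕ.+ 2 ℕ.* (c₀ ℕ.* ∑ c′)) ℕ.+ ∑ c′ ℕ.* ∑ c′
    ≡⟨ square c₀ (∑ c′) ⟩
  (c₀ ℕ.+ ∑ c′) ℕ.* (c₀ ℕ.+ ∑ c′) ∎
  where
  open ≡-Reasoning
  c₀ = c zero
  c′ : Fin n → ℕ
  c′ = c ∘ suc
  T = ∑ (λ u → ∑ (λ w → 𝟙 (does (u Fin.<? w)) ℕ.* (c′ u ℕ.* c′ w)))
  Q = ∑ (λ u → c′ u ℕ.* c′ u)
  row : ∑ (λ w → 1 ℕ.* (c₀ ℕ.* c′ w)) ≡ c₀ ℕ.* ∑ c′
  row = trans (sum-cong-≗ (λ w → ℕ.*-identityˡ (c₀ ℕ.* c′ w))) (sym (*-distribˡ-sum c₀ c′))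
  regroup : ∀ a s t q → 2 ℕ.* (a ℕ.* s ℕ.+ t) ℕ.+ (a ℕ.* a ℕ.+ q)
    ≡ (a ℕ.* a ℕ.+ 2 ℕ.* (a ℕ.* s)) ℕ.+ (2 ℕ.* t ℕ.+ q)
  regroup = ℕ-Ring.solve-∀
  square : ∀ a s → (a ℕ.* a ℕ.+ 2 ℕ.* (a ℕ.* s)) ℕ.+ s ℕ.* s ≡ (a ℕ.+ s) ℕ.* (a ℕ.+ s)
  square = ℕ-Ring.solve-∀

-- Serves to remove one vertex from a clique: with the terms at `z` split off both sums, the rest
-- agrees because `punchIn z` never takes the value `z`.
suc-∑ : ∀ {n} (f g : Fin n → ℕ) z → f z ≡ 0 → g z ≡ 1 → (∀ u → u ≢ z → f u ≡ g u) →
  suc (∑ f) ≡ ∑ g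
suc-∑ {suc n} f g z fz≡0 gz≡1 f≡g = begin
  suc (∑ f)                        ≡⟨ cong suc (sum-remove {i = z} f) ⟩
  suc (f z ℕ.+ ∑ (f ∘ punchIn z))  ≡⟨ cong₂ (λ a b → suc (a ℕ.+ b)) fz≡0
                                        (sum-cong-≗ (λ i → f≡g (punchIn z i) (punchInᵢ≢i z i))) ⟩
  1 ℕ.+ ∑ (g ∘ punchIn z)          ≡⟨ cong (ℕ._+ ∑ (g ∘ punchIn z)) gz≡1 ⟨
  g z ℕ.+ ∑ (g ∘ punchIn z)        ≡⟨ sum-remove {i = z} g ⟨
  ∑ g                              ∎
  where open ≡-Reasoning

-- Sums over the elements and over the pairs of a subset.

∣∣≡∑-lookup : ∀ {n} (p : Subset n) → ∣ p ∣ ≡ ∑ (λ i → 𝟙 (lookup p i))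
∣∣≡∑-lookup Vec.[]        = refl
∣∣≡∑-lookup (inside ∷ p)  = cong suc (∣∣≡∑-lookup p)
∣∣≡∑-lookup (outside ∷ p) = ∣∣≡∑-lookup p

does-∈? : ∀ {n} (p : Subset n) i → does (i ∈? p) ≡ lookup p i
does-∈? (inside ∷ p)  zero    = refl
does-∈? (outside ∷ p) zero    = refl
does-∈? (_ ∷ p)       (suc i) = does-∈? p i

module _ {v : ℕ} (S : Subset v) where

  [_∈S] : Fin v → ℕ
  [ u ∈S] = 𝟙 (does (u ∈? S))

  ∑∈S : ∑ [_∈S] ≡ ∣ S ∣
  ∑∈S = trans (sum-cong-≗ (λ u → cong 𝟙 (does-∈? S u))) (sym (∣∣≡∑-lookup S))

  sum-elements : (f : Fin v → ℕ) → sum (map f (elements S)) ≡ ∑ (λ u → [ u ∈S] ℕ.* f u)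
  sum-elements f = trans (sum-filter (_∈? S) f (allFin v)) (sum-allFin (λ u → [ u ∈S] ℕ.* f u))

  sum-elements-1 : sum (map (λ _ → 1) (elements S)) ≡ ∣ S ∣
  sum-elements-1 = trans (sum-elements (λ _ → 1))
    (trans (sum-cong-≗ (λ u → ℕ.*-identityʳ [ u ∈S])) ∑∈S)

  sum-pairs : (f : Fin v × Fin v → ℕ) → sum (map f (pairs S)) ≡
    ∑ (λ u → ∑ (λ w → [ u ∈S] ℕ.* ([ w ∈S] ℕ.* (𝟙 (does (u Fin.<? w)) ℕ.* f (u , w)))))
  sum-pairs f = begin
    sum (map f (pairs S))
      ≡⟨ sum-filter (λ (u , w) → u Fin.<? w) f (cartesianProduct (elements S) (elements S)) ⟩
    sum (map f< (cartesianProduct (elements S) (elements S)))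
      ≡⟨ sum-cartesianProduct f< (elements S) (elements S) ⟩
    sum (map (λ u → sum (map (λ w → f< (u , w)) (elements S))) (elements S))
      ≡⟨ sum-elements _ ⟩
    ∑ (λ u → [ u ∈S] ℕ.* sum (map (λ w → f< (u , w)) (elements S)))
      ≡⟨ sum-cong-≗ (λ u → trans (cong ([ u ∈S] ℕ.*_) (sum-elements (λ w → f< (u , w))))
           (*-distribˡ-sum [ u ∈S] (λ w → [ w ∈S] ℕ.* f< (u , w)))) ⟩
    ∑ (λ u → ∑ (λ w → [ u ∈S] ℕ.* ([ w ∈S] ℕ.* f< (u , w)))) ∎
    where
    open ≡-Reasoning
    f< : Fin v × Fin v → ℕ
    f< (u , w) = 𝟙 (does (u Fin.<? w)) ℕ.* f (u , w)

  -- An idempotent `h` is 0/1-valued, so `c u`, the product of `h u` with the indicator of `S`, is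
  -- its own square and the diagonal of `∑<-square` becomes `∑ c`. Taking `h` constantly 1 counts
  -- the pairs of `S`; taking adjacency to `z` counts the pairs of neighbours of `z` in `S`.
  sum-pairs-square : (h : Fin v → ℕ) → (∀ u → h u ℕ.* h u ≡ h u) →
    2 ℕ.* sum (map (λ (u , w) → h u ℕ.* h w) (pairs S)) ℕ.+ sum (map h (elements S))
      ≡ sum (map h (elements S)) ℕ.* sum (map h (elements S))
  sum-pairs-square h h-idem = begin
    2 ℕ.* sum (map (λ (u , w) → h u ℕ.* h w) (pairs S)) ℕ.+ sum (map h (elements S))
      ≡⟨ cong₂ (λ p m → 2 ℕ.* p ℕ.+ m) pairs≡ (trans (sum-elements h) (sum-cong-≗ (sym ∘ c-idem))) ⟩
    2 ℕ.* ∑ (λ u → ∑ (λ w → 𝟙 (does (u Fin.<? w)) ℕ.* (c u ℕ.* c w))) ℕ.+ ∑ (λ u → c u ℕ.* c u)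
      ≡⟨ ∑<-square c ⟩
    ∑ c ℕ.* ∑ c
      ≡⟨ cong₂ ℕ._*_ (sum-elements h) (sum-elements h) ⟨
    sum (map h (elements S)) ℕ.* sum (map h (elements S)) ∎
    where
    open ≡-Reasoning
    c : Fin v → ℕ
    c u = [ u ∈S] ℕ.* h u
    c-idem : ∀ u → c u ℕ.* c u ≡ c u
    c-idem u = trans (ℕ.[m*n]*[o*p]≡[m*o]*[n*p] [ u ∈S] (h u) [ u ∈S] (h u))
      (cong₂ ℕ._*_ (𝟙-idem (does (u ∈? S))) (h-idem u))
    regroup : ∀ i j b x y → i ℕ.* (j ℕ.* (b ℕ.* (x ℕ.* y))) ≡ b ℕ.* ((i ℕ.* x) ℕ.* (j ℕ.* y))
    regroup = ℕ-Ring.solve-∀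
    pairs≡ : sum (map (λ (u , w) → h u ℕ.* h w) (pairs S))
           ≡ ∑ (λ u → ∑ (λ w → 𝟙 (does (u Fin.<? w)) ℕ.* (c u ℕ.* c w)))
    pairs≡ = trans (sum-pairs _) (sum-cong-≗ λ u → sum-cong-≗ λ w →
      regroup [ u ∈S] [ w ∈S] (𝟙 (does (u Fin.<? w))) (h u) (h w))

-- Counting pairs, and inequalities between integers.

2*nC2+n≡n*n : ∀ n → 2 ℕ.* (n C 2) ℕ.+ n ≡ n ℕ.* n
2*nC2+n≡n*n zero    = refl
2*nC2+n≡n*n (suc n) = begin
  2 ℕ.* (suc n C 2) ℕ.+ suc n
    ≡⟨ cong (λ t → 2 ℕ.* t ℕ.+ suc n) (nCk+nC[k+1]≡[n+1]C[k+1] n 1) ⟨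
  2 ℕ.* (n C 1 ℕ.+ n C 2) ℕ.+ suc n
    ≡⟨ cong (λ t → 2 ℕ.* (t ℕ.+ n C 2) ℕ.+ suc n) (nC1≡n n) ⟩
  2 ℕ.* (n ℕ.+ n C 2) ℕ.+ suc n
    ≡⟨ regroup n (n C 2) ⟩
  (2 ℕ.* (n C 2) ℕ.+ n) ℕ.+ (2 ℕ.* n ℕ.+ 1)
    ≡⟨ cong (ℕ._+ (2 ℕ.* n ℕ.+ 1)) (2*nC2+n≡n*n n) ⟩
  n ℕ.* n ℕ.+ (2 ℕ.* n ℕ.+ 1)
    ≡⟨ square n ⟩
  suc n ℕ.* suc n ∎
  where
  open ≡-Reasoning
  regroup : ∀ n c → 2 ℕ.* (n ℕ.+ c) ℕ.+ (1 ℕ.+ n) ≡ (2 ℕ.* c ℕ.+ n) ℕ.+ (2 ℕ.* n ℕ.+ 1)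
  regroup = ℕ-Ring.solve-∀
  square : ∀ n → n ℕ.* n ℕ.+ (2 ℕ.* n ℕ.+ 1) ≡ (1 ℕ.+ n) ℕ.* (1 ℕ.+ n)
  square = ℕ-Ring.solve-∀

-- Both numbers solve the same equation: doubled and increased by `∣ S ∣`, each gives the square of
-- `∣ S ∣`.
length-pairs : ∀ {v} (S : Subset v) → length (pairs S) ≡ ∣ S ∣ C 2
length-pairs S = ℕ.*-cancelˡ-≡ _ _ 2 (ℕ.+-cancelʳ-≡ ∣ S ∣ _ _ (begin
  2 ℕ.* length (pairs S) ℕ.+ ∣ S ∣
    ≡⟨ cong₂ (λ p m → 2 ℕ.* p ℕ.+ m) (sum-map-1 (pairs S)) (sum-elements-1 S) ⟨
  2 ℕ.* sum (map (λ _ → 1) (pairs S)) ℕ.+ sum (map (λ _ → 1) (elements S))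
    ≡⟨ sum-pairs-square S (λ _ → 1) (λ _ → refl) ⟩
  sum (map (λ _ → 1) (elements S)) ℕ.* sum (map (λ _ → 1) (elements S))
    ≡⟨ cong₂ ℕ._*_ (sum-elements-1 S) (sum-elements-1 S) ⟩
  ∣ S ∣ ℕ.* ∣ S ∣
    ≡⟨ 2*nC2+n≡n*n ∣ S ∣ ⟨
  2 ℕ.* (∣ S ∣ C 2) ℕ.+ ∣ S ∣ ∎))
  where open ≡-Reasoning

-- Consecutive integers never have opposite signs. This is why `x` has to be an integer: the product
-- is negative for a real `d` strictly between 0 and 1.
0≤d*[d-1] : ∀ d → + 0 ℤ.≤ d ℤ.* (d ℤ.- + 1)
0≤d*[d-1] (+ zero)  = +≤+ z≤n
0≤d*[d-1] (+ suc n) = subst (+ 0 ℤ.≤_) (ℤ.pos-* (suc n) n) (+≤+ z≤n)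
0≤d*[d-1] -[1+ n ]  = +≤+ z≤n

-- Adds up the pointwise bounds. The casts stand outside the sums: `+ a ℤ.+ + b` computes to
-- `+ (a ℕ.+ b)`, so splitting off index `zero` takes no rewriting of casts.
weighted-sum-≤ : ∀ {n} (c P m : Fin n → ℕ) (k t y w : ℤ) →
  (∀ z → + c z ℤ.* k ℤ.≤ t ℤ.* + P z ℤ.- y ℤ.* + m z ℤ.+ w) →
  + ∑ c ℤ.* k ℤ.≤ t ℤ.* + ∑ P ℤ.- y ℤ.* + ∑ m ℤ.+ + n ℤ.* w
weighted-sum-≤ {zero}  c P m k t y w h = ℤ.≤-reflexive (base k t y w)
  where
  base : ∀ k t y w → + 0 ℤ.* k ≡ t ℤ.* + 0 ℤ.- y ℤ.* + 0 ℤ.+ + 0 ℤ.* w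
  base = ℤ-Ring.solve-∀
weighted-sum-≤ {suc n} c P m k t y w h = begin
  (+ c zero ℤ.+ + ∑ (c ∘ suc)) ℤ.* k
    ≡⟨ ℤ.*-distribʳ-+ k (+ c zero) (+ ∑ (c ∘ suc)) ⟩
  + c zero ℤ.* k ℤ.+ + ∑ (c ∘ suc) ℤ.* k
    ≤⟨ ℤ.+-mono-≤ (h zero) (weighted-sum-≤ (c ∘ suc) (P ∘ suc) (m ∘ suc) k t y w (h ∘ suc)) ⟩
  (t ℤ.* + P zero ℤ.- y ℤ.* + m zero ℤ.+ w)
    ℤ.+ (t ℤ.* + ∑ (P ∘ suc) ℤ.- y ℤ.* + ∑ (m ∘ suc) ℤ.+ + n ℤ.* w)
    ≡⟨ step t y w (+ P zero) (+ ∑ (P ∘ suc)) (+ m zero) (+ ∑ (m ∘ suc)) (+ n) ⟩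
  t ℤ.* (+ P zero ℤ.+ + ∑ (P ∘ suc)) ℤ.- y ℤ.* (+ m zero ℤ.+ + ∑ (m ∘ suc)) ℤ.+ (+ 1 ℤ.+ + n) ℤ.* w ∎
  where
  open ℤ.≤-Reasoning
  step : ∀ t y w p p′ m m′ n →
    (t ℤ.* p ℤ.- y ℤ.* m ℤ.+ w) ℤ.+ (t ℤ.* p′ ℤ.- y ℤ.* m′ ℤ.+ n ℤ.* w)
      ≡ t ℤ.* (p ℤ.+ p′) ℤ.- y ℤ.* (m ℤ.+ m′) ℤ.+ (+ 1 ℤ.+ n) ℤ.* w
  step = ℤ-Ring.solve-∀

-- Double counting between a clique and all vertices.

module _ {v} (Γ : Graph v) where
  open Graph Γ

  [_~_] : Fin v → Fin v → ℕ
  [ u ~ w ] = 𝟙 (does (adj? u w))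

  degree≡∑ : ∀ u → degree Γ u ≡ ∑ [ u ~_]
  degree≡∑ u = trans (∣∣≡∑-lookup (neighbours Γ u))
    (sum-cong-≗ (λ z → cong 𝟙 (Vec.lookup∘tabulate (λ w → does (adj? u w)) z)))

  commonNeighbours≡∑ : ∀ u w → commonNeighbours Γ u w ≡ ∑ (λ z → [ u ~ z ] ℕ.* [ w ~ z ])
  commonNeighbours≡∑ u w = trans (∣∣≡∑-lookup (neighbours Γ u ∩ neighbours Γ w))
    (sum-cong-≗ λ z → begin
      𝟙 (lookup (neighbours Γ u ∩ neighbours Γ w) z)
        ≡⟨ cong 𝟙 (Vec.lookup-zipWith _∧_ z (neighbours Γ u) (neighbours Γ w)) ⟩
      𝟙 (lookup (neighbours Γ u) z ∧ lookup (neighbours Γ w) z)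
        ≡⟨ cong₂ (λ a b → 𝟙 (a ∧ b)) (Vec.lookup∘tabulate _ z) (Vec.lookup∘tabulate _ z) ⟩
      𝟙 (does (adj? u z) ∧ does (adj? w z))
        ≡⟨ 𝟙-∧ (does (adj? u z)) (does (adj? w z)) ⟩
      [ u ~ z ] ℕ.* [ w ~ z ] ∎)
    where open ≡-Reasoning

  module _ (S : Subset v) where

    degreeSum : ℕ
    degreeSum = sum (map (degree Γ) (elements S))

    commonNeighbourSum : ℕ
    commonNeighbourSum = sum (map (λ (u , w) → commonNeighbours Γ u w) (pairs S))

    neighboursIn : Fin v → ℕ
    neighboursIn z = sum (map [_~ z ] (elements S))

    -- This is `neighboursIn z` choose 2, kept as a sum over pairs so that it can be exchanged with
    -- the sum over `z`.
    neighbourPairsIn : Fin v → ℕ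
    neighbourPairsIn z = sum (map (λ (u , w) → [ u ~ z ] ℕ.* [ w ~ z ]) (pairs S))

    -- Counts the adjacent pairs `(u , z)` with `u` in `S` in two orders; `z` runs over all
    -- vertices, those of `S` included.
    degreeSum≡∑ : degreeSum ≡ ∑ neighboursIn
    degreeSum≡∑ = trans (cong sum (List.map-cong degree≡∑ (elements S)))
      (sum-∑-comm [_~_] (elements S))

    -- Counts in two orders the pairs from `S` together with a common neighbour `z`, again over all
    -- vertices `z`.
    commonNeighbourSum≡∑ : commonNeighbourSum ≡ ∑ neighbourPairsIn
    commonNeighbourSum≡∑ =
      trans (cong sum (List.map-cong (λ (u , w) → commonNeighbours≡∑ u w) (pairs S)))
        (sum-∑-comm (λ (u , w) z → [ u ~ z ] ℕ.* [ w ~ z ]) (pairs S))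

    neighbourPairsIn-square : ∀ z →
      2 ℕ.* neighbourPairsIn z ℕ.+ neighboursIn z ≡ neighboursIn z ℕ.* neighboursIn z
    neighbourPairsIn-square z = sum-pairs-square S [_~ z ] (λ u → 𝟙-idem (does (adj? u z)))

    module _ {s} (clique : IsClique Γ s S) (x : ℤ) where

      -- The clique property makes `z` adjacent to every other member of `S`, and irreflexivity
      -- excludes `z` itself. The form with `suc` avoids truncated subtraction.
      neighboursIn-∈ : ∀ {z} → z Subset.∈ S → suc (neighboursIn z) ≡ s
      neighboursIn-∈ {z} z∈S = begin
        suc (neighboursIn z)
          ≡⟨ cong suc (sum-elements S [_~ z ]) ⟩
        suc (∑ (λ u → [_∈S] S u ℕ.* [ u ~ z ]))
          ≡⟨ suc-∑ (λ u → [_∈S] S u ℕ.* [ u ~ z ]) ([_∈S] S) z at-z in-S off-z ⟩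
        ∑ ([_∈S] S)
          ≡⟨ ∑∈S S ⟩
        ∣ S ∣
          ≡⟨ proj₁ clique ⟩
        s ∎
        where
        open ≡-Reasoning
        at-z : [_∈S] S z ℕ.* [ z ~ z ] ≡ 0
        at-z = trans (cong (λ b → [_∈S] S z ℕ.* 𝟙 b) (dec-false (adj? z z) (irrefl refl)))
          (ℕ.*-zeroʳ ([_∈S] S z))
        in-S : [_∈S] S z ≡ 1
        in-S = cong 𝟙 (dec-true (z ∈? S) z∈S)
        off-z : ∀ u → u ≢ z → [_∈S] S u ℕ.* [ u ~ z ] ≡ [_∈S] S u
        off-z u u≢z with u ∈? S
        ... | yes u∈S = cong (λ b → 1 ℕ.* 𝟙 b) (dec-true (adj? u z) (proj₂ clique u∈S z∈S u≢z))
        ... | no  _   = refl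

      private
        -- The value of `(m - x) * (m - x - 1)` at a vertex of `S`, where `m = s - 1`.
        k : ℤ
        k = (+ s ℤ.- + 1 ℤ.- x) ℤ.* (+ s ℤ.- + 1 ℤ.- x ℤ.- + 1)

      -- Substituting `2p = m * m - m` turns the left side into a quadratic in `m - x`. The left
      -- side is linear in the two counts, which is the form that can be summed over `z`.
      complete-square : ∀ z → let m = + neighboursIn z in
        + 2 ℤ.* + neighbourPairsIn z ℤ.- + 2 ℤ.* x ℤ.* m ℤ.+ x ℤ.* (x ℤ.+ + 1)
          ≡ (m ℤ.- x) ℤ.* (m ℤ.- x ℤ.- + 1)
      complete-square z = begin
        + 2 ℤ.* p ℤ.- + 2 ℤ.* x ℤ.* m ℤ.+ x ℤ.* (x ℤ.+ + 1)
          ≡⟨ regroup p m x ⟩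
        (+ 2 ℤ.* p ℤ.+ m) ℤ.- m ℤ.- + 2 ℤ.* x ℤ.* m ℤ.+ x ℤ.* (x ℤ.+ + 1)
          ≡⟨ cong (λ q → q ℤ.- m ℤ.- + 2 ℤ.* x ℤ.* m ℤ.+ x ℤ.* (x ℤ.+ + 1)) 2p+m≡m² ⟩
        m ℤ.* m ℤ.- m ℤ.- + 2 ℤ.* x ℤ.* m ℤ.+ x ℤ.* (x ℤ.+ + 1)
          ≡⟨ factor m x ⟩
        (m ℤ.- x) ℤ.* (m ℤ.- x ℤ.- + 1) ∎
        where
        open ≡-Reasoning
        p = + neighbourPairsIn z
        m = + neighboursIn z
        2p+m≡m² : + 2 ℤ.* p ℤ.+ m ≡ m ℤ.* m
        2p+m≡m² = trans (cong (ℤ._+ m) (sym (ℤ.pos-* 2 (neighbourPairsIn z))))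
          (trans (cong +_ (neighbourPairsIn-square z)) (ℤ.pos-* (neighboursIn z) (neighboursIn z)))
        regroup : ∀ p m x → + 2 ℤ.* p ℤ.- + 2 ℤ.* x ℤ.* m ℤ.+ x ℤ.* (x ℤ.+ + 1)
          ≡ (+ 2 ℤ.* p ℤ.+ m) ℤ.- m ℤ.- + 2 ℤ.* x ℤ.* m ℤ.+ x ℤ.* (x ℤ.+ + 1)
        regroup = ℤ-Ring.solve-∀
        factor : ∀ m x → m ℤ.* m ℤ.- m ℤ.- + 2 ℤ.* x ℤ.* m ℤ.+ x ℤ.* (x ℤ.+ + 1)
          ≡ (m ℤ.- x) ℤ.* (m ℤ.- x ℤ.- + 1)
        factor = ℤ-Ring.solve-∀

      -- Equality on `S` and nonnegativity off `S`, merged by the indicator into one inequality that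
      -- can be summed over all vertices.
      vertex-bound : ∀ z → + [_∈S] S z ℤ.* k ℤ.≤
        + 2 ℤ.* + neighbourPairsIn z ℤ.- + 2 ℤ.* x ℤ.* + neighboursIn z ℤ.+ x ℤ.* (x ℤ.+ + 1)
      vertex-bound z with z ∈? S
      ... | yes z∈S = ℤ.≤-reflexive (trans (ℤ.*-identityˡ k)
        (trans (cong (λ m → (m ℤ.- x) ℤ.* (m ℤ.- x ℤ.- + 1)) s-1≡m) (sym (complete-square z))))
        where
        s-1≡m : + s ℤ.- + 1 ≡ + neighboursIn z
        s-1≡m = cong (λ n → + n ℤ.- + 1) (sym (neighboursIn-∈ z∈S))
      ... | no  _   = subst (+ 0 ℤ.≤_) (sym (complete-square z)) (0≤d*[d-1] (+ neighboursIn z ℤ.- x))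

      -- `CA` at the averages of `S` with the denominators cleared: `s * ⟨k⟩` becomes `degreeSum`,
      -- and `s * (s - 1) * ⟨λ⟩` becomes twice `commonNeighbourSum`.
      CAℤ : ℤ
      CAℤ = x ℤ.* (x ℤ.+ + 1) ℤ.* (+ v ℤ.- + s)
        ℤ.- + 2 ℤ.* x ℤ.* (+ degreeSum ℤ.+ + s ℤ.* (+ 1 ℤ.- + s))
        ℤ.+ (+ 2 ℤ.* + commonNeighbourSum
             ℤ.+ + s ℤ.* (+ s ℤ.- + 1) ℤ.* (+ 2 ℤ.- + s))

      -- The sum of `vertex-bound` over all vertices has `s * k` on its left. Subtracting it leaves
      -- the contribution of the vertices outside `S`, which `expand` identifies with `CAℤ`.
      CAℤ-nonneg : + 0 ℤ.≤ CAℤ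
      CAℤ-nonneg = subst (+ 0 ℤ.≤_) (expand (+ s) (+ v) x (+ degreeSum) (+ commonNeighbourSum)) (ℤ.i≤j⇒0≤j-i bound)
        where
        bound : + s ℤ.* k ℤ.≤
          + 2 ℤ.* + commonNeighbourSum
          ℤ.- + 2 ℤ.* x ℤ.* + degreeSum ℤ.+ + v ℤ.* (x ℤ.* (x ℤ.+ + 1))
        bound = subst₂ (λ p d → + s ℤ.* k ℤ.≤ + 2 ℤ.* + p ℤ.- + 2 ℤ.* x ℤ.* + d ℤ.+ + v ℤ.* (x ℤ.* (x ℤ.+ + 1)))
          (sym commonNeighbourSum≡∑) (sym degreeSum≡∑)
          (subst (λ n → + n ℤ.* k ℤ.≤ + 2 ℤ.* + ∑ neighbourPairsIn ℤ.- + 2 ℤ.* x ℤ.* + ∑ neighboursIn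
                                       ℤ.+ + v ℤ.* (x ℤ.* (x ℤ.+ + 1)))
            (trans (∑∈S S) (proj₁ clique))
            (weighted-sum-≤ ([_∈S] S) neighbourPairsIn neighboursIn
              k (+ 2) (+ 2 ℤ.* x) (x ℤ.* (x ℤ.+ + 1)) vertex-bound))
        expand : ∀ s v x d p →
          (+ 2 ℤ.* p ℤ.- + 2 ℤ.* x ℤ.* d ℤ.+ v ℤ.* (x ℤ.* (x ℤ.+ + 1)))
            ℤ.- s ℤ.* ((s ℤ.- + 1 ℤ.- x) ℤ.* (s ℤ.- + 1 ℤ.- x ℤ.- + 1))
          ≡ x ℤ.* (x ℤ.+ + 1) ℤ.* (v ℤ.- s)
            ℤ.- + 2 ℤ.* x ℤ.* (d ℤ.+ s ℤ.* (+ 1 ℤ.- s))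
            ℤ.+ (+ 2 ℤ.* p ℤ.+ s ℤ.* (s ℤ.- + 1) ℤ.* (+ 2 ℤ.- s))
        expand = ℤ-Ring.solve-∀

-- Integers and averages as rationals.

fromℚᵘ-homo-+ : ∀ p q → ℚ.fromℚᵘ (p ℚᵘ.+ q) ≡ ℚ.fromℚᵘ p ℚ.+ ℚ.fromℚᵘ q
fromℚᵘ-homo-+ p q = ℚ.toℚᵘ-injective (ℚᵘ.≃-trans (ℚ.toℚᵘ-fromℚᵘ (p ℚᵘ.+ q))
  (ℚᵘ.≃-sym (ℚᵘ.≃-trans (ℚ.toℚᵘ-homo-+ (ℚ.fromℚᵘ p) (ℚ.fromℚᵘ q))
    (ℚᵘ.+-cong (ℚ.toℚᵘ-fromℚᵘ p) (ℚ.toℚᵘ-fromℚᵘ q)))))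

fromℚᵘ-homo-* : ∀ p q → ℚ.fromℚᵘ (p ℚᵘ.* q) ≡ ℚ.fromℚᵘ p ℚ.* ℚ.fromℚᵘ q
fromℚᵘ-homo-* p q = ℚ.toℚᵘ-injective (ℚᵘ.≃-trans (ℚ.toℚᵘ-fromℚᵘ (p ℚᵘ.* q))
  (ℚᵘ.≃-sym (ℚᵘ.≃-trans (ℚ.toℚᵘ-homo-* (ℚ.fromℚᵘ p) (ℚ.fromℚᵘ q))
    (ℚᵘ.*-cong (ℚ.toℚᵘ-fromℚᵘ p) (ℚ.toℚᵘ-fromℚᵘ q)))))

-- Every term of the sequence of `fromℤ i` is `ι i`, so the terms of `CA` compute to expressions in
-- `ι`.
ι : ℤ → ℚ
ι i = i ℚ./ 1

ι-+ : ∀ i j → ι (i ℤ.+ j) ≡ ι i ℚ.+ ι j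
ι-+ i j = trans (ℚ.fromℚᵘ-cong {mkℚᵘ (i ℤ.+ j) 0} {mkℚᵘ i 0 ℚᵘ.+ mkℚᵘ j 0} (*≡* (eq i j)))
    (fromℚᵘ-homo-+ (mkℚᵘ i 0) (mkℚᵘ j 0))
  where
  eq : ∀ i j → (i ℤ.+ j) ℤ.* + 1 ≡ (i ℤ.* + 1 ℤ.+ j ℤ.* + 1) ℤ.* + 1
  eq = ℤ-Ring.solve-∀

ι-* : ∀ i j → ι (i ℤ.* j) ≡ ι i ℚ.* ι j
ι-* i j = fromℚᵘ-homo-* (mkℚᵘ i 0) (mkℚᵘ j 0)

ι-neg : ∀ i → ι (ℤ.- i) ≡ ℚ.- ι i
ι-neg (+ zero)  = refl
ι-neg (+ suc n) = refl
ι-neg -[1+ n ]  = sym (⁻¹-involutive (ι (+ suc n)))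
  where open import Algebra.Properties.Group ℚ.+-0-group using (⁻¹-involutive)

ι-- : ∀ i j → ι (i ℤ.- j) ≡ ι i ℚ.- ι j
ι-- i j = trans (ι-+ i (ℤ.- j)) (cong (ι i ℚ.+_) (ι-neg j))

0≤ι : ∀ {i} → + 0 ℤ.≤ i → 0ℚ ℚ.≤ ι i
0≤ι {+ n} _ = ℚ.nonNegative⁻¹ (ι (+ n)) {{ℚ.normalize-nonNeg n 1}}

-- For `n = 0` the left side is 0, so the total has to vanish as well; this is the case covered by
-- the hypothesis.
*-average : ∀ t n → (n ≡ 0 → t ≡ 0) → ι (+ n) ℚ.* average t n ≡ ι (+ t)
*-average t zero      h = cong (λ t → ι (+ t)) (sym (h refl))
*-average t n@(suc m) h = trans (sym (fromℚᵘ-homo-* (mkℚᵘ (+ n) 0) (mkℚᵘ (+ t) m)))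
  (ℚ.fromℚᵘ-cong {mkℚᵘ (+ n) 0 ℚᵘ.* mkℚᵘ (+ t) m} {mkℚᵘ (+ t) 0}
    (*≡* (trans (eq (+ n) (+ t)) (cong (λ d → + t ℤ.* + d) (sym (ℕ.*-identityˡ n))))))
  where
  eq : ∀ n t → n ℤ.* t ℤ.* + 1 ≡ t ℤ.* n
  eq = ℤ-Ring.solve-∀

sum-map-empty : ∀ {A : Set} (f : A → ℕ) xs → length xs ≡ 0 → sum (map f xs) ≡ 0
sum-map-empty f [] _ = refl

-- The value of `CA` at the averages of a clique, and the contradiction.

module _ {v} (Γ : Graph v) (S : Subset v) where

  private
    n D P : ℕ
    n = ∣ S ∣
    D = degreeSum Γ S
    P = commonNeighbourSum Γ S

  ∣S∣*⟨k⟩ : ι (+ n) ℚ.* ⟨k⟩ Γ S ≡ ι (+ D)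
  ∣S∣*⟨k⟩ = *-average D n λ ∣S∣≡0 →
    sum-map-empty (degree Γ) (elements S)
      (trans (sym (sum-map-1 (elements S))) (trans (sum-elements-1 S) ∣S∣≡0))

  ∣S∣*[∣S∣-1]*⟨λ⟩ : ι (+ n) ℚ.* (ι (+ n) ℚ.- ι (+ 1)) ℚ.* ⟨λ⟩ Γ S ≡ ι (+ 2) ℚ.* ι (+ P)
  ∣S∣*[∣S∣-1]*⟨λ⟩ = begin
    ι (+ n) ℚ.* (ι (+ n) ℚ.- ι (+ 1)) ℚ.* ⟨λ⟩ Γ S
      ≡⟨ cong (λ q → ι (+ n) ℚ.* q ℚ.* ⟨λ⟩ Γ S) (ι-- (+ n) (+ 1)) ⟨
    ι (+ n) ℚ.* ι (+ n ℤ.- + 1) ℚ.* ⟨λ⟩ Γ S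
      ≡⟨ cong (ℚ._* ⟨λ⟩ Γ S) (ι-* (+ n) (+ n ℤ.- + 1)) ⟨
    ι (+ n ℤ.* (+ n ℤ.- + 1)) ℚ.* ⟨λ⟩ Γ S
      ≡⟨ cong (λ i → ι i ℚ.* ⟨λ⟩ Γ S) n*[n-1]≡2*nC2 ⟩
    ι (+ 2 ℤ.* + (n C 2)) ℚ.* ⟨λ⟩ Γ S
      ≡⟨ cong (ℚ._* ⟨λ⟩ Γ S) (ι-* (+ 2) (+ (n C 2))) ⟩
    ι (+ 2) ℚ.* ι (+ (n C 2)) ℚ.* ⟨λ⟩ Γ S
      ≡⟨ ℚ.*-assoc (ι (+ 2)) (ι (+ (n C 2))) (⟨λ⟩ Γ S) ⟩
    ι (+ 2) ℚ.* (ι (+ (n C 2)) ℚ.* ⟨λ⟩ Γ S)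
      -- If `n C 2` is 0, as for a one-element clique, there are no pairs and `P = 0`, in agreement
      -- with the default value 0 of `⟨λ⟩`.
      ≡⟨ cong (ι (+ 2) ℚ.*_) (*-average P (n C 2) λ nC2≡0 →
           sum-map-empty _ (pairs S) (trans (length-pairs S) nC2≡0)) ⟩
    ι (+ 2) ℚ.* ι (+ P) ∎
    where
    open ≡-Reasoning
    expand : ∀ n → n ℤ.* (n ℤ.- + 1) ≡ n ℤ.* n ℤ.- n
    expand = ℤ-Ring.solve-∀
    cancel : ∀ c n → + 2 ℤ.* c ℤ.+ n ℤ.- n ≡ + 2 ℤ.* c
    cancel = ℤ-Ring.solve-∀
    n*[n-1]≡2*nC2 : + n ℤ.* (+ n ℤ.- + 1) ≡ + 2 ℤ.* + (n C 2)
    n*[n-1]≡2*nC2 = begin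
      + n ℤ.* (+ n ℤ.- + 1)                ≡⟨ expand (+ n) ⟩
      + n ℤ.* + n ℤ.- + n                  ≡⟨ cong (ℤ._- + n) (ℤ.pos-* n n) ⟨
      + (n ℕ.* n) ℤ.- + n                  ≡⟨ cong (λ q → + q ℤ.- + n) (2*nC2+n≡n*n n) ⟨
      + (2 ℕ.* (n C 2)) ℤ.+ + n ℤ.- + n    ≡⟨ cong (λ q → q ℤ.+ + n ℤ.- + n) (ℤ.pos-* 2 (n C 2)) ⟩
      + 2 ℤ.* + (n C 2) ℤ.+ + n ℤ.- + n    ≡⟨ cancel (+ (n C 2)) (+ n) ⟩
      + 2 ℤ.* + (n C 2)                    ∎

  module _ {s} (clique : IsClique Γ s S) (x : ℤ) where

    -- All reals involved are constant sequences, so each term is one rational expression.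
    -- Regrouping isolates `s * ⟨k⟩` and `s * (s - 1) * ⟨λ⟩`, the products that are integers.
    CA≡CAℤ : ∀ n → seq (CA Γ x s (fromℚ (⟨k⟩ Γ S)) (fromℚ (⟨λ⟩ Γ S))) n ≡ ι (CAℤ Γ S clique x)
    CA≡CAℤ n = begin
      seq (CA Γ x s (fromℚ (⟨k⟩ Γ S)) (fromℚ (⟨λ⟩ Γ S))) n
        ≡⟨ regroup X V s′ o t (⟨k⟩ Γ S) (⟨λ⟩ Γ S) ⟩
      A ℚ.- t ℚ.* X ℚ.* (s′ ℚ.* ⟨k⟩ Γ S ℚ.+ s′ ℚ.* (o ℚ.- s′))
        ℚ.+ (s′ ℚ.* (s′ ℚ.- o) ℚ.* ⟨λ⟩ Γ S ℚ.+ s′ ℚ.* (s′ ℚ.- o) ℚ.* (t ℚ.- s′))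
        ≡⟨ cong₂ (λ d p → A ℚ.- t ℚ.* X ℚ.* (d ℚ.+ s′ ℚ.* (o ℚ.- s′))
             ℚ.+ (p ℚ.+ s′ ℚ.* (s′ ℚ.- o) ℚ.* (t ℚ.- s′))) s*⟨k⟩ s*[s-1]*⟨λ⟩ ⟩
      A ℚ.- t ℚ.* X ℚ.* (ι (+ D) ℚ.+ s′ ℚ.* (o ℚ.- s′))
        ℚ.+ (t ℚ.* ι (+ P) ℚ.+ s′ ℚ.* (s′ ℚ.- o) ℚ.* (t ℚ.- s′))
        ≡⟨ cong₂ ℚ._+_ (cong₂ ℚ._-_ ιA ιB) ιC ⟨
      ι a ℚ.- ι b ℚ.+ ι c
        ≡⟨ cong (ℚ._+ ι c) (ι-- a b) ⟨
      ι (a ℤ.- b) ℚ.+ ι c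
        ≡⟨ ι-+ (a ℤ.- b) c ⟨
      ι (CAℤ Γ S clique x) ∎
      where
      open ≡-Reasoning
      X = ι x
      V = ι (+ v)
      s′ = ι (+ s)
      o = ι (+ 1)
      t = ι (+ 2)
      A = X ℚ.* (X ℚ.+ o) ℚ.* (V ℚ.- s′)
      a = x ℤ.* (x ℤ.+ + 1) ℤ.* (+ v ℤ.- + s)
      b = + 2 ℤ.* x ℤ.* (+ D ℤ.+ + s ℤ.* (+ 1 ℤ.- + s))
      c = + 2 ℤ.* + P ℤ.+ + s ℤ.* (+ s ℤ.- + 1) ℤ.* (+ 2 ℤ.- + s)
      s*⟨k⟩ : s′ ℚ.* ⟨k⟩ Γ S ≡ ι (+ D)
      s*⟨k⟩ = subst (λ n → ι (+ n) ℚ.* ⟨k⟩ Γ S ≡ ι (+ D)) (proj₁ clique) ∣S∣*⟨k⟩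
      s*[s-1]*⟨λ⟩ : s′ ℚ.* (s′ ℚ.- o) ℚ.* ⟨λ⟩ Γ S ≡ t ℚ.* ι (+ P)
      s*[s-1]*⟨λ⟩ = subst (λ n → ι (+ n) ℚ.* (ι (+ n) ℚ.- o) ℚ.* ⟨λ⟩ Γ S ≡ t ℚ.* ι (+ P))
        (proj₁ clique) ∣S∣*[∣S∣-1]*⟨λ⟩
      ιA : ι a ≡ A
      ιA = trans (ι-* (x ℤ.* (x ℤ.+ + 1)) (+ v ℤ.- + s))
        (cong₂ ℚ._*_ (trans (ι-* x (x ℤ.+ + 1)) (cong (X ℚ.*_) (ι-+ x (+ 1)))) (ι-- (+ v) (+ s)))
      ιB : ι b ≡ t ℚ.* X ℚ.* (ι (+ D) ℚ.+ s′ ℚ.* (o ℚ.- s′))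
      ιB = trans (ι-* (+ 2 ℤ.* x) (+ D ℤ.+ + s ℤ.* (+ 1 ℤ.- + s)))
        (cong₂ ℚ._*_ (ι-* (+ 2) x)
          (trans (ι-+ (+ D) (+ s ℤ.* (+ 1 ℤ.- + s)))
            (cong (ι (+ D) ℚ.+_) (trans (ι-* (+ s) (+ 1 ℤ.- + s)) (cong (s′ ℚ.*_) (ι-- (+ 1) (+ s)))))))
      ιC : ι c ≡ t ℚ.* ι (+ P) ℚ.+ s′ ℚ.* (s′ ℚ.- o) ℚ.* (t ℚ.- s′)
      ιC = trans (ι-+ (+ 2 ℤ.* + P) (+ s ℤ.* (+ s ℤ.- + 1) ℤ.* (+ 2 ℤ.- + s)))
        (cong₂ ℚ._+_ (ι-* (+ 2) (+ P))
          (trans (ι-* (+ s ℤ.* (+ s ℤ.- + 1)) (+ 2 ℤ.- + s))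
            (cong₂ ℚ._*_ (trans (ι-* (+ s) (+ s ℤ.- + 1)) (cong (s′ ℚ.*_) (ι-- (+ s) (+ 1))))
              (ι-- (+ 2) (+ s)))))
      -- The constants 1 and 2 are kept as variables o and t: the identity is polynomial in them.
      regroup : ∀ X V s o t k l →
        X ℚ.* (X ℚ.+ o) ℚ.* (V ℚ.- s) ℚ.- t ℚ.* X ℚ.* s ℚ.* (k ℚ.- s ℚ.+ o)
          ℚ.+ s ℚ.* (s ℚ.- o) ℚ.* (l ℚ.- s ℚ.+ t)
        ≡ X ℚ.* (X ℚ.+ o) ℚ.* (V ℚ.- s) ℚ.- t ℚ.* X ℚ.* (s ℚ.* k ℚ.+ s ℚ.* (o ℚ.- s))
          ℚ.+ (s ℚ.* (s ℚ.- o) ℚ.* l ℚ.+ s ℚ.* (s ℚ.- o) ℚ.* (t ℚ.- s))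
      regroup = solve 7 (λ X V s o t k l →
        X :* (X :+ o) :* (V :- s) :- t :* X :* s :* (k :- s :+ o) :+ s :* (s :- o) :* (l :- s :+ t)
        := X :* (X :+ o) :* (V :- s) :- t :* X :* (s :* k :+ s :* (o :- s))
          :+ (s :* (s :- o) :* l :+ s :* (s :- o) :* (t :- s))) refl
        where open +-*-Solver

    CA-nonneg : ∀ n → 0ℚ ℚ.≤ seq (CA Γ x s (fromℚ (⟨k⟩ Γ S)) (fromℚ (⟨λ⟩ Γ S))) n
    CA-nonneg n = subst (0ℚ ℚ.≤_) (sym (CA≡CAℤ n)) (0≤ι (CAℤ-nonneg Γ S clique x))

-- At the index `N` supplied by `_<_`, the positive gap `ε` plus a nonnegative term would be at most
-- 0.
≮0 : ∀ x → (∀ n → 0ℚ ℚ.≤ seq x n) → ¬ (x < fromℕ 0)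
≮0 x 0≤x (ε , 0<ε , N , x+ε≤0) =
  ℚ.<-irrefl refl (ℚ.<-≤-trans (ℚ.+-mono-≤-< (0≤x N) 0<ε) (x+ε≤0 N ℕ.≤-refl))

theorem1p1 : ∀ {ℓ} {v : ℕ} (Γ : Graph v) (s : ℕ) .{{_ : NonZero s}} →
    (F : Pred (ℝ × ℝ) ℓ) → F Respects _≃₂_ →
    (∀ (S : Subset v) → IsClique Γ s S → (fromℚ (⟨k⟩ Γ S) , fromℚ (⟨λ⟩ Γ S)) ∈ F) →
    (∀ k l → (k , l) ∈ F → ∃[ x ] CA Γ x s k l < fromℕ 0) →
    ¬ (∃[ S ] IsClique Γ s S)
theorem1p1 Γ s F _ averages∈F CA<0 (S , clique)
  -- The hypothesis on `F` is applied to the averages of the assumed clique itself; nonnegativity of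
  -- `CA` there holds for every integer, hence for this `x`.
  with x , CA[x]<0 ← CA<0 _ _ (averages∈F S clique)
  = ≮0 (CA Γ x s (fromℚ (⟨k⟩ Γ S)) (fromℚ (⟨λ⟩ Γ S))) (CA-nonneg Γ S clique x) CA[x]<0
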